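{- Let $H$ be a weakly-reducible bipartite graph. Then for all sufficiently large $n$, $\mathrm{nim}_2(n;H)=\mathrm{ex}(n,H)$. Furthermore, every 2-edge-colouring of $K_n$ attaining $\mathrm{nim}_2(n;H)$ has one of its colour classes isomorphic to a maximum $H$-free graph of order $n$.
   Context: For a 2-edge-colouring of $K_n$, an edge is a NIM-edge if it is not contained in any copy of $H$ all of whose edges have the same colour; $\mathrm{nim}_2(n;H)$ is the maximum number of NIM-edges over all 2-edge-colourings of $K_n$. $\mathrm{ex}(n,H)$ is the maximum number of edges in an $H$-free graph on $n$ vertices. An $h$-vertex graph $H$ is weakly-reducible if there exist $n_0$ and a vertex $v\in V(H)$ such that $\mathrm{ex}(n,H-v)<\mathrm{ex}(n,H)-2^{2h^2}n$ for all $n\ge n_0$. -}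

module Defs where

open import Level using (0ℓ)
open import Data.Nat as ℕ using (ℕ; suc; _+_; _*_; _^_; _≥_)
open import Data.Fin as Fin using (Fin; punchIn)
open import Data.Bool using (Bool)
open import Data.List using (List; length)
open import Data.List.Membership.Propositional using (_∈_)
open import Data.List.Relation.Unary.Unique.Propositional using (Unique)
open import Data.Product using (Σ; ∃; ∃-syntax; _×_; _,_)
open import Relation.Nullary using (¬_)
open import Relation.Binary.PropositionalEquality using (_≡_; _≢_; sym)
open import Function.Definitions using (Injective)

record Graph (n : ℕ) : Set₁ where
  field
    Adj    : Fin n → Fin n → Set
    adjSym : ∀ {x y} → Adj x y → Adj y x
    irrefl : ∀ {x} → ¬ Adj x x
open Graph public

-- "the set of unordered pairs {x,y} (x ≠ y) satisfying P has exactly m elements";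
-- unordered pairs are represented by ordered pairs (x , y) with x < y.
HasCount : {n : ℕ} → (Fin n → Fin n → Set) → ℕ → Set
HasCount {n} P m =
  Σ (List (Fin n × Fin n)) λ xs →
    Unique xs × length xs ≡ m
    × (∀ x y → (x , y) ∈ xs → (x Fin.< y) × P x y)
    × (∀ x y → x Fin.< y → P x y → (x , y) ∈ xs)

NumEdges : {n : ℕ} → Graph n → ℕ → Set
NumEdges G m = HasCount (Adj G) m

IsCopy : {h n : ℕ} → Graph h → Graph n → (Fin h → Fin n) → Set
IsCopy H G f = Injective _≡_ _≡_ f × (∀ i j → Adj H i j → Adj G (f i) (f j))

Contains : {h n : ℕ} → Graph n → Graph h → Set
Contains {h} {n} G H = Σ (Fin h → Fin n) (IsCopy H G)

HFree : {h n : ℕ} → Graph n → Graph h → Set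
HFree G H = ¬ Contains G H

IsEx : {h : ℕ} → (n : ℕ) → Graph h → ℕ → Set₁
IsEx n H m =
  (Σ (Graph n) λ G → HFree G H × NumEdges G m)
  × (∀ (G : Graph n) m' → HFree G H → NumEdges G m' → m' ℕ.≤ m)

IsMaxHFree : {h n : ℕ} → Graph n → Graph h → Set₁
IsMaxHFree {n = n} G H = HFree G H × Σ ℕ λ m → IsEx n H m × NumEdges G m

deleteVertex : {k : ℕ} → Graph (suc k) → Fin (suc k) → Graph k
deleteVertex H v = record
  { Adj    = λ i j → Adj H (punchIn v i) (punchIn v j)
  ; adjSym = adjSym H
  ; irrefl = irrefl H
  }

Bipartite : {h : ℕ} → Graph h → Set
Bipartite {h} H = Σ (Fin h → Bool) λ c → ∀ i j → Adj H i j → c i ≢ c j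

WeaklyReducible : {k : ℕ} → Graph (suc k) → Set₁
WeaklyReducible {k} H =
  Σ ℕ λ n₀ → Σ (Fin (suc k)) λ v → ∀ n → n ≥ n₀ →
    Σ ℕ λ a → Σ ℕ λ b →
      IsEx n (deleteVertex H v) a × IsEx n H b
      × (a + 2 ^ (2 * (suc k * suc k)) * n ℕ.< b)

-- 2-edge-colourings of K_n (colour of edge {x,y} is col x y; diagonal irrelevant)
record Colouring (n : ℕ) : Set where
  field
    col    : Fin n → Fin n → Bool
    colSym : ∀ x y → col x y ≡ col y x
open Colouring public

colourClass : {n : ℕ} → Colouring n → Bool → Graph n
colourClass χ c = record
  { Adj    = λ x y → (x ≢ y) × (col χ x y ≡ c)
  ; adjSym = λ { {x} {y} (ne , e) → (λ q → ne (sym q)) , Relation.Binary.PropositionalEquality.trans (colSym χ y x) e }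
  ; irrefl = λ { (ne , _) → ne Relation.Binary.PropositionalEquality.refl }
  }

InMonoCopy : {h n : ℕ} → Graph h → Colouring n → Fin n → Fin n → Set
InMonoCopy {h} {n} H χ x y =
  Σ Bool λ c → Σ (Fin h → Fin n) λ f → IsCopy H (colourClass χ c) f
    × Σ (Fin h) λ i → Σ (Fin h) λ j → Adj H i j × f i ≡ x × f j ≡ y

IsNIM : {h n : ℕ} → Graph h → Colouring n → Fin n → Fin n → Set
IsNIM H χ x y = (x ≢ y) × ¬ InMonoCopy H χ x y

NumNIM : {h n : ℕ} → Graph h → Colouring n → ℕ → Set
NumNIM H χ m = HasCount (IsNIM H χ) m

IsNim : {h : ℕ} → (n : ℕ) → Graph h → ℕ → Set
IsNim n H m =
  (Σ (Colouring n) λ χ → NumNIM H χ m)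
  × (∀ (χ : Colouring n) m' → NumNIM H χ m' → m' ℕ.≤ m)

Iso : {n : ℕ} → Graph n → Graph n → Set
Iso {n} G G' = Σ (Fin n → Fin n) λ f → Σ (Fin n → Fin n) λ g →
  (∀ x → g (f x) ≡ x) × (∀ y → f (g y) ≡ y)
  × (∀ x y → (Adj G x y → Adj G' (f x) (f y)) × (Adj G' (f x) (f y) → Adj G x y))

{-# OPTIONS --safe #-}

-- Colouring the edges of an extremal H-free graph with one colour gives nim ≥ ex, and a NIM-graph of a single colour is
-- H-free. So the point is that NIM-edges of both colours force fewer than ex(n,H) of them in total; write h = |H|,
-- J = H - v. Otherwise the NIM-graph has more than ex(n,J) + 2^(2h²) n edges, hence still contains copies of J after any
-- constant number of vertices and, at each vertex, any suitably bounded number of edges have been deleted.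
-- For a set S of bounded size, all but boundedly many c-coloured NIM-edges at each vertex avoid the vertices with at least
-- h c-neighbours in S, since otherwise a c-coloured K_{h,h} would contain one of them. Delete the exceptions for a
-- monochromatic clique S of size 2h, of colour c say: every component of a remaining copy of J is then monochromatic, and
-- the endpoints of an edge whose colour is not c have many c-neighbours in S. Such an endpoint p cannot be c-adjacent to
-- the whole c-coloured part of another copy, as p in the role of v and vertices of S for the rest would complete it to a
-- c-coloured H. Hence p has a neighbour of the other colour in each of h disjoint copies having c-edges, and deleting the
-- exceptions for their union T leaves only copies all of whose edges have colour c; if h such copies do not exist, then
-- only copies of the other colour are left.
-- So let all copies have colour c, and let xy be a NIM-edge of the other colour c'. Each copy has a c'-neighbour d of y;
-- after deleting the exceptions for a set Z of 2h c'-neighbours of x, these d have many c'-neighbours in Z, and x, Z and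
-- y, with many such d, give a c'-coloured copy of H through xy.
module Submission where

open import Defs
open import Data.Nat using (ℕ; zero; suc; _+_; _*_; _^_; _≤_; _<_; _≥_; z≤n; s≤s; s≤s⁻¹; _≤?_; _<?_)
open import Data.Nat.Properties
open import Data.Bool using (Bool; true; false; not)
import Data.Bool.Properties as Bool
open import Data.Fin as Fin using (Fin; zero; suc; punchIn; punchOut; inject≤)
import Data.Fin.Properties as Fin
open import Data.List using (List; []; _∷_; _++_; length; lookup; filter; map; concatMap; allFin; take)
open import Data.List.Properties using (length-++; length-map; filter-++; length-filter; length-take; take-all; length-tabulate)
open import Data.List.Membership.Propositional using (_∈_; _∉_; lose; find)
open import Data.List.Membership.Propositional.Properties
open import Data.List.Relation.Unary.Any as Any using (here; there)
open import Data.List.Relation.Unary.All as All using (All; []; _∷_)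
open import Data.List.Relation.Unary.AllPairs as AllPairs using (AllPairs; []; _∷_)
import Data.List.Relation.Unary.AllPairs.Properties as AllPairs
open import Data.List.Relation.Unary.Unique.Propositional using (Unique)
import Data.List.Relation.Unary.Unique.Propositional.Properties as Unique
open import Data.Product using (Σ; ∃; ∃₂; _×_; _,_; proj₁; proj₂; swap)
import Data.Product.Properties as Product
open import Data.Sum using (_⊎_; inj₁; inj₂; [_,_]′)
open import Data.Empty using (⊥; ⊥-elim)
open import Data.Vec.Functional using (insertAt)
open import Data.Vec.Functional.Properties using (insertAt-lookup; insertAt-punchIn)
open import Function using (_∘_; id)
open import Function.Definitions using (Injective)
open import Function.Bundles using (mk⇔)
open import Relation.Nullary using (Dec; yes; no; ¬_; contradiction; ¬?; _×-dec_; _⊎-dec_)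
open import Relation.Nullary.Decidable using (does; does-⇔; dec-true; decidable-stable; ¬¬-excluded-middle)
open import Relation.Unary using (Decidable)
open import Relation.Binary.Definitions using (tri<; tri≈; tri>)
open import Relation.Binary.PropositionalEquality using (_≡_; _≢_; refl; sym; trans; cong; subst; subst₂; ≢-sym)

-- Counting in duplicate-free lists, equal colour patterns and finite choice

private variable
  X Y : Set

unique-⊆⇒length≤ : {xs ys : List X} → Unique xs → (∀ {x} → x ∈ xs → x ∈ ys) → length xs ≤ length ys
unique-⊆⇒length≤ {xs = []} _ _ = z≤n
unique-⊆⇒length≤ {xs = x ∷ xs} (x∉xs ∷ u) xs⊆ys with ∈-∃++ (xs⊆ys (here refl))
... | as , bs , refl = begin
  suc (length xs)               ≤⟨ s≤s (unique-⊆⇒length≤ u sub) ⟩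
  suc (length (as ++ bs))       ≡⟨ cong suc (length-++ as) ⟩
  suc (length as + length bs)   ≡⟨ +-suc (length as) (length bs) ⟨
  length as + suc (length bs)   ≡⟨ length-++ as ⟨
  length (as ++ x ∷ bs)         ∎
  where
  open ≤-Reasoning
  sub : ∀ {y} → y ∈ xs → y ∈ as ++ bs
  sub y∈xs with ∈-++⁻ as (xs⊆ys (there y∈xs))
  ... | inj₁ y∈as         = ∈-++⁺ˡ y∈as
  ... | inj₂ (here refl)  = contradiction refl (All.lookup x∉xs y∈xs)
  ... | inj₂ (there y∈bs) = ∈-++⁺ʳ as y∈bs

length-filter-cover : {P Q : X → Set} (P? : Decidable P) (Q? : Decidable Q) → (∀ x → P x ⊎ Q x) →
  ∀ xs → length xs ≤ length (filter P? xs) + length (filter Q? xs)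
length-filter-cover P? Q? cover [] = z≤n
length-filter-cover P? Q? cover (x ∷ xs) with ih ← length-filter-cover P? Q? cover xs | P? x | Q? x
... | yes _ | yes _ = s≤s (≤-trans ih (+-monoʳ-≤ (length (filter P? xs)) (n≤1+n _)))
... | yes _ | no _  = s≤s ih
... | no _  | yes _ = ≤-trans (s≤s ih) (≤-reflexive (sym (+-suc (length (filter P? xs)) _)))
... | no ¬p | no ¬q = ⊥-elim ([ ¬p , ¬q ]′ (cover x))

length-concatMap≤ : (f : X → List Y) {d : ℕ} → (∀ x → length (f x) ≤ d) → ∀ xs → length (concatMap f xs) ≤ length xs * d
length-concatMap≤ f bound []       = z≤n
length-concatMap≤ f bound (x ∷ xs) =
  ≤-trans (≤-reflexive (length-++ (f x))) (+-mono-≤ (bound x) (length-concatMap≤ f bound xs))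

∉-++ : {x : X} (xs : List X) {ys : List X} → x ∉ xs ++ ys → x ∉ xs × x ∉ ys
∉-++ xs x∉ = x∉ ∘ ∈-++⁺ˡ , x∉ ∘ ∈-++⁺ʳ xs

∈∧∉⇒≢ : {x y : X} {xs : List X} → x ∈ xs → y ∉ xs → x ≢ y
∈∧∉⇒≢ x∈ y∉ refl = y∉ x∈

∈-take⁻ : ∀ m (xs : List X) {x} → x ∈ take m xs → x ∈ xs
∈-take⁻ (suc m) (y ∷ xs) (here p)  = here p
∈-take⁻ (suc m) (y ∷ xs) (there p) = there (∈-take⁻ m xs p)

length-take-≤ : ∀ m (xs : List X) → length (take m xs) ≤ m
length-take-≤ m xs = ≤-trans (≤-reflexive (length-take m xs)) (m⊓n≤m m (length xs))

length-take-≡ : ∀ {m} (xs : List X) → m ≤ length xs → length (take m xs) ≡ m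
length-take-≡ {m = m} xs m≤ = trans (length-take m xs) (m≤n⇒m⊓n≡m m≤)

∷-unique : {x : X} {xs : List X} → x ∉ xs → Unique xs → Unique (x ∷ xs)
∷-unique x∉xs u = All.tabulate (λ y∈xs → λ { refl → x∉xs y∈xs }) ∷ u

lookup-AllPairs : {R : X → X → Set} → (∀ {x y} → R x y → R y x) → {xs : List X} → AllPairs R xs →
  ∀ {i j} → i ≢ j → R (lookup xs i) (lookup xs j)
lookup-AllPairs sy (_ ∷ ps) {zero}  {zero}  i≢j = contradiction refl i≢j
lookup-AllPairs sy (p ∷ _)  {zero}  {suc j} _   = All.lookup p (∈-lookup j)
lookup-AllPairs sy (p ∷ _)  {suc i} {zero}  _   = sy (All.lookup p (∈-lookup i))
lookup-AllPairs sy (_ ∷ ps) {suc i} {suc j} i≢j = lookup-AllPairs sy ps (i≢j ∘ cong suc)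

lookup-injective : {xs : List X} → Unique xs → ∀ {i j} → lookup xs i ≡ lookup xs j → i ≡ j
lookup-injective u {i} {j} e with i Fin.≟ j
... | yes i≡j = i≡j
... | no i≢j  = contradiction e (lookup-AllPairs ≢-sym u i≢j)

select : ∀ {m} (xs : List X) → m ≤ length xs → Fin m → X
select xs m≤ i = lookup xs (inject≤ i m≤)

select-∈ : ∀ {m} (xs : List X) (m≤ : m ≤ length xs) i → select xs m≤ i ∈ xs
select-∈ xs m≤ i = ∈-lookup (inject≤ i m≤)

select-injective : ∀ {m} {xs : List X} → Unique xs → (m≤ : m ≤ length xs) → ∀ {i j} → select xs m≤ i ≡ select xs m≤ j → i ≡ j
select-injective u m≤ e = Fin.inject≤-injective m≤ m≤ _ _ (lookup-injective u e)

select-AllPairs : {R : X → X → Set} → (∀ {x y} → R x y → R y x) → ∀ {m} {xs : List X} → AllPairs R xs →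
  (m≤ : m ≤ length xs) → ∀ {i j} → i ≢ j → R (select xs m≤ i) (select xs m≤ j)
select-AllPairs sy ps m≤ i≢j = lookup-AllPairs sy ps (i≢j ∘ Fin.inject≤-injective m≤ m≤ _ _)

≡⊎≡not : ∀ b c → b ≡ c ⊎ b ≡ not c
≡⊎≡not false false = inj₁ refl
≡⊎≡not false true  = inj₂ refl
≡⊎≡not true  false = inj₂ refl
≡⊎≡not true  true  = inj₁ refl

average : ∀ {m p q} → m + m ≤ p + q → m ≤ p ⊎ m ≤ q
average {m} {p} {q} le with m ≤? p | m ≤? q
... | yes m≤p | _       = inj₁ m≤p
... | no _    | yes m≤q = inj₂ m≤q
... | no m≰p  | no m≰q  = contradiction (+-mono-< (≰⇒> m≰p) (≰⇒> m≰q)) (≤⇒≯ le)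

-- Halving the list at each element of S according to its colour keeps a 2^-|S| proportion of it.
equal-patterns : (f : X → Y → Bool) (S : List Y) {L : List X} {m : ℕ} → Unique L → 2 ^ length S * m ≤ length L →
  ∃ λ L′ → Unique L′ × (∀ {u} → u ∈ L′ → u ∈ L) × m ≤ length L′
    × (∀ {u u′ z} → u ∈ L′ → u′ ∈ L′ → z ∈ S → f u z ≡ f u′ z)
equal-patterns f [] {L} {m} u len =
  L , u , id , ≤-trans (≤-reflexive (sym (*-identityˡ m))) len , λ _ _ ()
equal-patterns {X = X} f (z ∷ S) {L} {m} u len =
  [ half true , half false ]′ (average (≤-trans doubled (length-filter-cover (is true) (is false) true-or-false L)))
  where
  is : (b : Bool) → Decidable (λ w → f w z ≡ b)
  is b w = f w z Bool.≟ b
  true-or-false : ∀ w → f w z ≡ true ⊎ f w z ≡ false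
  true-or-false w = ≡⊎≡not (f w z) true
  open ≤-Reasoning
  doubled : 2 ^ length S * m + 2 ^ length S * m ≤ length L
  doubled = begin
    2 ^ length S * m + 2 ^ length S * m       ≡⟨ cong (2 ^ length S * m +_) (+-identityʳ _) ⟨
    2 * (2 ^ length S * m)                    ≡⟨ *-assoc 2 (2 ^ length S) m ⟨
    2 ^ length (z ∷ S) * m                    ≤⟨ len ⟩
    length L                                  ∎
  half : ∀ b → 2 ^ length S * m ≤ length (filter (is b) L) →
    ∃ λ L′ → Unique L′ × (∀ {w} → w ∈ L′ → w ∈ L) × m ≤ length L′
      × (∀ {w w′ y} → w ∈ L′ → w′ ∈ L′ → y ∈ z ∷ S → f w y ≡ f w′ y)
  half b len′ with equal-patterns f S (Unique.filter⁺ (is b) u) len′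
  ... | L′ , u′ , sub , m≤ , agree = L′ , u′ , proj₁ ∘ ∈-filter⁻ (is b) ∘ sub , m≤ , agree′
    where
    at-z : ∀ {w} → w ∈ L′ → f w z ≡ b
    at-z = proj₂ ∘ ∈-filter⁻ (is b) {xs = L} ∘ sub
    agree′ : ∀ {w w′ y} → w ∈ L′ → w′ ∈ L′ → y ∈ z ∷ S → f w y ≡ f w′ y
    agree′ p q (here refl) = trans (at-z p) (sym (at-z q))
    agree′ p q (there y∈S) = agree p q y∈S

-- Adjacency in `H` is an arbitrary relation. This double-negation shift lets a decision for every
-- pair of vertices be assumed at once when the goal is stable.
¬¬-finite : ∀ {n} {P : Fin n → Set} → (∀ i → ¬ ¬ P i) → ¬ ¬ (∀ i → P i)
¬¬-finite {zero}  f k = k λ ()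
¬¬-finite {suc n} f k = f zero λ p → ¬¬-finite (f ∘ suc) λ ps → k λ { zero → p ; (suc i) → ps i }

-- Edge lists and copies of H

module _ {n : ℕ} where

  Edge : List (Fin n × Fin n) → Fin n → Fin n → Set
  Edge xs x y = (x , y) ∈ xs ⊎ (y , x) ∈ xs

  edge? : ∀ xs x y → Dec (Edge xs x y)
  edge? xs x y = ((x , y) ∈? xs) ⊎-dec ((y , x) ∈? xs)
    where open import Data.List.Membership.DecPropositional (Product.≡-dec (Fin._≟_ {n}) (Fin._≟_ {n})) using (_∈?_)

  edge-sym : ∀ {xs x y} → Edge xs x y → Edge xs y x
  edge-sym = [ inj₂ , inj₁ ]′

  Ordered : List (Fin n × Fin n) → Set
  Ordered xs = ∀ {x y} → (x , y) ∈ xs → x Fin.< y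

  edge-ordered : ∀ {xs x y} → Ordered xs → x Fin.< y → Edge xs x y → (x , y) ∈ xs
  edge-ordered ord x<y (inj₁ xy) = xy
  edge-ordered ord x<y (inj₂ yx) = contradiction (ord yx) (<⇒≯ x<y)

  edgeGraph : ∀ xs → Ordered xs → Graph n
  edgeGraph xs ord = record
    { Adj    = Edge xs
    ; adjSym = edge-sym
    ; irrefl = [ <-irrefl refl ∘ ord , <-irrefl refl ∘ ord ]′
    }

  edgeGraph-NumEdges : ∀ {xs} (ord : Ordered xs) → Unique xs → NumEdges (edgeGraph xs ord) (length xs)
  edgeGraph-NumEdges {xs} ord u = xs , u , refl , (λ x y xy → ord xy , inj₁ xy) , λ x y → edge-ordered ord

  data View {k : ℕ} (v : Fin (suc k)) : Fin (suc k) → Set where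
    deleted : View v v
    kept    : ∀ j → View v (punchIn v j)

  view : ∀ {k} (v x : Fin (suc k)) → View v x
  view v x with v Fin.≟ x
  ... | yes refl = deleted
  ... | no v≢x   = subst (View v) (Fin.punchIn-punchOut v≢x) (kept (punchOut v≢x))

  insert-copy : ∀ {k} (H : Graph (suc k)) v (G : Graph n) {g : Fin k → Fin n} {w} → IsCopy (deleteVertex H v) G g →
    (∀ j → w ≢ g j) → (∀ j → Adj H v (punchIn v j) → Adj G w (g j)) → IsCopy H G (insertAt g v w)
  insert-copy {k} H v G {g} {w} (g-injective , g-adj) w≢g w~g = injective , adj
    where
    g⁺ : Fin (suc k) → Fin n
    g⁺ = insertAt g v w
    g⁺-v : g⁺ v ≡ w
    g⁺-v = insertAt-lookup g v w
    g⁺-kept : ∀ j → g⁺ (punchIn v j) ≡ g j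
    g⁺-kept = insertAt-punchIn g v w
    injective : Injective _≡_ _≡_ g⁺
    injective {x} {y} e with view v x | view v y
    ... | deleted | deleted = refl
    ... | deleted | kept j  = contradiction (trans (sym g⁺-v) (trans e (g⁺-kept j))) (w≢g j)
    ... | kept i  | deleted = contradiction (trans (sym g⁺-v) (trans (sym e) (g⁺-kept i))) (w≢g i)
    ... | kept i  | kept j  = cong (punchIn v) (g-injective (trans (sym (g⁺-kept i)) (trans e (g⁺-kept j))))
    adj : ∀ x y → Adj H x y → Adj G (g⁺ x) (g⁺ y)
    adj x y x~y with view v x | view v y
    ... | deleted | deleted = contradiction x~y (irrefl H)
    ... | deleted | kept j  = subst₂ (Adj G) (sym g⁺-v) (sym (g⁺-kept j)) (w~g j x~y)
    ... | kept i  | deleted = subst₂ (Adj G) (sym (g⁺-kept i)) (sym g⁺-v) (adjSym G (w~g i (adjSym H x~y)))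
    ... | kept i  | kept j  = subst₂ (Adj G) (sym (g⁺-kept i)) (sym (g⁺-kept j)) (g-adj i j x~y)

  -- The soundness half of `NumNIM`: the list may omit NIM-edges. Upper bounds can thus be applied
  -- to lists not known to be complete, as in `extremal-colouring`.
  AllNIM : ∀ {h} → Graph h → Colouring n → List (Fin n × Fin n) → Set
  AllNIM H χ xs = ∀ x y → (x , y) ∈ xs → x Fin.< y × IsNIM H χ x y

  edge⇒¬InMonoCopy : ∀ {h} (H : Graph h) χ {xs} → AllNIM H χ xs → ∀ {x y} → Edge xs x y → ¬ InMonoCopy H χ x y
  edge⇒¬InMonoCopy H χ nim (inj₁ xy) = proj₂ (proj₂ (nim _ _ xy))
  edge⇒¬InMonoCopy H χ nim (inj₂ yx) (c , f , copy , i , j , i~j , fi , fj) =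
    proj₂ (proj₂ (nim _ _ yx)) (c , f , copy , j , i , adjSym H i~j , fj , fi)

-- Monochromatic cliques

module Colours {n : ℕ} (χ : Colouring n) where

  Mono : Bool → Fin n → Fin n → Set
  Mono c = Adj (colourClass χ c)

  mono-sym : ∀ {c x y} → Mono c x y → Mono c y x
  mono-sym {c} = adjSym (colourClass χ c)

  Clique : Bool → List (Fin n) → Set
  Clique c = AllPairs (Mono c)

  -- The Erdős-Szekeres recursion with the crude bound 2^(p+q): at least half of the required number
  -- of vertices are joined to `w` in one colour, and `w` extends a clique of that colour found
  -- among them.
  ramsey : ∀ p q {L} → Unique L → 2 ^ (p + q) ≤ length L →
    (∃ λ S → Clique true S × length S ≡ p × (∀ {z} → z ∈ S → z ∈ L))
    ⊎ (∃ λ S → Clique false S × length S ≡ q × (∀ {z} → z ∈ S → z ∈ L))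
  ramsey zero    q       u _ = inj₁ ([] , [] , refl , λ ())
  ramsey (suc p) zero    u _ = inj₂ ([] , [] , refl , λ ())
  ramsey (suc p) (suc q) {[]} _ len = contradiction (≤-trans (m^n>0 2 (suc p + suc q)) len) λ ()
  ramsey (suc p) (suc q) {w ∷ L} (w∉L ∷ u) len = by-majority
    where
    is : (b : Bool) → Decidable (λ y → col χ w y ≡ b)
    is b y = col χ w y Bool.≟ b
    N : Bool → List (Fin n)
    N b = filter (is b) L
    in-N : ∀ b {S z} → (∀ {y} → y ∈ S → y ∈ N b) → z ∈ S → Mono b w z
    in-N b sub z∈S = let z∈L , e = ∈-filter⁻ (is b) {xs = L} (sub z∈S) in All.lookup w∉L z∈L , e
    widen : ∀ b {S} → (∀ {y} → y ∈ S → y ∈ N b) → ∀ {z} → z ∈ S → z ∈ w ∷ L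
    widen b sub = there ∘ proj₁ ∘ ∈-filter⁻ (is b) ∘ sub
    insert : ∀ b {S} → Clique b S → (∀ {y} → y ∈ S → y ∈ N b) →
      Clique b (w ∷ S) × (∀ {z} → z ∈ w ∷ S → z ∈ w ∷ L)
    insert b cl sub = (All.tabulate (in-N b sub) ∷ cl) , λ { (here e) → here e ; (there z∈S) → widen b sub z∈S }
    M : ℕ
    M = 2 ^ (p + suc q)
    open ≤-Reasoning
    -- The extra one is `w` itself. It is harmless: if both neighbourhoods had fewer than `M`
    -- elements, the right side would still be below `M + M`.
    large : M + M ≤ length (N true) + suc (length (N false))
    large = begin
      M + M                                     ≡⟨ cong (M +_) (+-identityʳ M) ⟨
      2 ^ (suc p + suc q)                       ≤⟨ len ⟩
      suc (length L)                            ≤⟨ s≤s (length-filter-cover (is true) (is false) (λ y → ≡⊎≡not _ true) L) ⟩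
      suc (length (N true) + length (N false))  ≡⟨ +-suc (length (N true)) _ ⟨
      length (N true) + suc (length (N false))  ∎
    by-majority : (∃ λ S → Clique true S × length S ≡ suc p × (∀ {z} → z ∈ S → z ∈ w ∷ L))
      ⊎ (∃ λ S → Clique false S × length S ≡ suc q × (∀ {z} → z ∈ S → z ∈ w ∷ L))
    by-majority with M ≤? length (N true) | M ≤? length (N false)
    ... | yes M≤ | _ with ramsey p (suc q) (Unique.filter⁺ (is true) u) M≤
    ...   | inj₁ (S , cl , e , sub) = let cl′ , sub′ = insert true cl sub in inj₁ (w ∷ S , cl′ , cong suc e , sub′)
    ...   | inj₂ (S , cl , e , sub) = inj₂ (S , cl , e , widen true sub)
    by-majority | no _ | yes M≤ with ramsey (suc p) q (Unique.filter⁺ (is false) u)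
                                       (≤-trans (≤-reflexive (cong (2 ^_) (sym (+-suc p q)))) M≤)
    ...   | inj₁ (S , cl , e , sub) = inj₁ (S , cl , e , widen false sub)
    ...   | inj₂ (S , cl , e , sub) = let cl′ , sub′ = insert false cl sub in inj₂ (w ∷ S , cl′ , cong suc e , sub′)
    by-majority | no M≰t | no M≰f =
      contradiction (≤-trans large (≤-trans (+-monoʳ-≤ (length (N true)) (≰⇒> M≰f)) ≤-refl))
        (<⇒≱ (+-monoˡ-< M (≰⇒> M≰t)))

  deg : Bool → List (Fin n) → Fin n → ℕ
  deg c S w = length (filter (λ z → col χ w z Bool.≟ c) S)

  deg-cover : ∀ c S w → length S ≤ deg c S w + deg (not c) S w
  deg-cover c S w = length-filter-cover _ _ (λ z → ≡⊎≡not (col χ w z) c) S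

  deg-++ : ∀ c S T w → deg c (S ++ T) w ≡ deg c S w + deg c T w
  deg-++ c S T w = trans (cong length (filter-++ _ S T)) (length-++ (filter _ S))

  nbs : Bool → Fin n → List (Fin n)
  nbs c w = filter (λ u → ¬? (w Fin.≟ u) ×-dec (col χ w u Bool.≟ c)) (allFin n)

  ∈-nbs⁻ : ∀ {c w u} → u ∈ nbs c w → Mono c w u
  ∈-nbs⁻ = proj₂ ∘ ∈-filter⁻ _ {xs = allFin n}

  ∈-nbs⁺ : ∀ {c w u} → Mono c w u → u ∈ nbs c w
  ∈-nbs⁺ {u = u} m = ∈-filter⁺ _ (∈-allFin u) m

  nbs-unique : ∀ c w → Unique (nbs c w)
  nbs-unique c w = Unique.filter⁺ _ (Unique.allFin⁺ n)

-- NIM-edges of both colours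

module Nim {n k : ℕ} (H : Graph (suc k)) (H? : ∀ i j → Dec (Adj H i j)) (v : Fin (suc k)) (bipartite : Bipartite H)
           (χ : Colouring n) (xs : List (Fin n × Fin n))
           (nim : AllNIM H χ xs) where

  open Colours χ

  h : ℕ
  h = suc k

  J : Graph k
  J = deleteVertex H v

  J? : ∀ i j → Dec (Adj J i j)
  J? i j = H? (punchIn v i) (punchIn v j)

  side : Fin h → Bool
  side = proj₁ bipartite

  -- Monochromatic copies of `H` through a given edge

  place : Fin n → (A : List (Fin n)) → h ≤ length A → Fin h → Fin h → Fin n
  place p A h≤A i x with x Fin.≟ i
  ... | yes _ = p
  ... | no _  = select A h≤A x

  place-∈ : ∀ p A h≤A i x → place p A h≤A i x ∈ p ∷ A
  place-∈ p A h≤A i x with x Fin.≟ i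
  ... | yes _ = here refl
  ... | no _  = there (select-∈ A h≤A x)

  place-≡ : ∀ p A h≤A i → place p A h≤A i i ≡ p
  place-≡ p A h≤A i with i Fin.≟ i
  ... | yes _  = refl
  ... | no i≢i = contradiction refl i≢i

  place-injective : ∀ {p A} → Unique (p ∷ A) → ∀ h≤A i {x y} → place p A h≤A i x ≡ place p A h≤A i y → x ≡ y
  place-injective {A = A} (p∉A ∷ u) h≤A i {x} {y} e with x Fin.≟ i | y Fin.≟ i
  ... | yes refl | yes refl = refl
  ... | yes _    | no _     = contradiction e (All.lookup p∉A (select-∈ A h≤A y))
  ... | no _     | yes _    = contradiction (sym e) (All.lookup p∉A (select-∈ A h≤A x))
  ... | no _     | no _     = select-injective u h≤A e

  -- The vertices on the side of `i` go into `p ∷ A`, the others into `q ∷ D`. Each list has room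
  -- for all of `H`, so a vertex simply takes the entry with its own index, except that `i` is
  -- diverted to `p` and `j` to `q`.
  biclique⇒InMonoCopy : ∀ c {p q A D} → h ≤ length A → h ≤ length D → Unique (p ∷ A) → Unique (q ∷ D) →
    (∀ {x y} → x ∈ p ∷ A → y ∈ q ∷ D → Mono c x y) → ∀ {i j} → Adj H i j → InMonoCopy H χ p q
  biclique⇒InMonoCopy c {p} {q} {A} {D} h≤A h≤D uA uD cross {i} {j} i~j =
    c , f , (f-injective , λ x y → f-adj x y) , i , j , i~j , f-i , f-j
    where
    a b : Fin h → Fin n
    a = place p A h≤A i
    b = place q D h≤D j
    a~b : ∀ x y → Mono c (a x) (b y)
    a~b x y = cross (place-∈ p A h≤A i x) (place-∈ q D h≤D j y)
    f : Fin h → Fin n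
    f x with side x Bool.≟ side i
    ... | yes _ = a x
    ... | no _  = b x
    f-injective : Injective _≡_ _≡_ f
    f-injective {x} {y} e with side x Bool.≟ side i | side y Bool.≟ side i
    ... | yes _ | yes _ = place-injective uA h≤A i e
    ... | yes _ | no _  = contradiction e (proj₁ (a~b x y))
    ... | no _  | yes _ = contradiction (sym e) (proj₁ (a~b y x))
    ... | no _  | no _  = place-injective uD h≤D j e
    f-adj : ∀ x y → Adj H x y → Mono c (f x) (f y)
    f-adj x y x~y with side x Bool.≟ side i | side y Bool.≟ side i
    ... | yes p | yes q = contradiction (trans p (sym q)) (proj₂ bipartite x y x~y)
    ... | yes _ | no _  = a~b x y
    ... | no _  | yes _ = mono-sym (a~b y x)
    ... | no p  | no q  = contradiction (trans (Bool.¬-not p) (sym (Bool.¬-not q))) (proj₂ bipartite x y x~y)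
    f-i : f i ≡ p
    f-i with side i Bool.≟ side i
    ... | yes _ = place-≡ p A h≤A i
    ... | no q  = contradiction refl q
    f-j : f j ≡ q
    f-j with side j Bool.≟ side i
    ... | yes e = contradiction (sym e) (proj₂ bipartite i j i~j)
    ... | no _  = place-≡ q D h≤D j

  module _ (c : Bool) (w : Fin n) (f : Fin k → Fin n) (f-injective : Injective _≡_ _≡_ f)
           {Q : Fin k → Set} (Q? : Decidable Q)
           (closed : ∀ {i j} → Adj J i j → Q i → Q j)
           (coloured : ∀ {i j} → Adj J i j → Q i → Mono c (f i) (f j))
           (w~f : ∀ {j} → Q j → Mono c w (f j))
           (P : List (Fin n)) (k≤P : k ≤ length P) (P-unique : Unique P)
           (w~P : ∀ {z} → z ∈ P → Mono c w z)
           (f∉P : ∀ {j} → Q j → f j ∉ P)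
           -- `Q` is a union of components of `J`, so `P` has to be a clique only if some edge of
           -- `J` lies outside `Q`. When `Q` consists of the non-isolated vertices, the condition is
           -- vacuous.
           (P-adj : ∀ {i j} → Adj J i j → ¬ Q i → ¬ Q j → Clique c P)
           where

    private
      g : Fin k → Fin n
      g j with Q? j
      ... | yes _ = f j
      ... | no _  = select P k≤P j

      g-f : ∀ {j} → Q j → g j ≡ f j
      g-f {j} q with Q? j
      ... | yes _ = refl
      ... | no ¬q = contradiction q ¬q

      w~g : ∀ j → Mono c w (g j)
      w~g j with Q? j
      ... | yes q = w~f q
      ... | no _  = w~P (select-∈ P k≤P j)

      g-injective : ∀ {i j} → g i ≡ g j → i ≡ j
      g-injective {i} {j} e with Q? i | Q? j
      ... | yes _ | yes _ = f-injective e
      ... | yes q | no _  = contradiction (subst (_∈ P) (sym e) (select-∈ P k≤P j)) (f∉P q)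
      ... | no _  | yes q = contradiction (subst (_∈ P) e (select-∈ P k≤P i)) (f∉P q)
      ... | no _  | no _  = select-injective P-unique k≤P e

      g-adj : ∀ {i j} → Adj J i j → Mono c (g i) (g j)
      g-adj {i} {j} i~j with Q? i | Q? j
      ... | yes q | yes _ = coloured i~j q
      ... | yes q | no ¬q = contradiction (closed i~j q) ¬q
      ... | no ¬q | yes q = contradiction (closed (adjSym J i~j) q) ¬q
      ... | no ¬q | no ¬r = select-AllPairs mono-sym (P-adj i~j ¬q ¬r) k≤P λ { refl → irrefl J i~j }

    -- The copy sends the deleted vertex to w, agrees with f on Q and uses P for everything else.
    extend⇒InMonoCopy : ∀ {i j} → Adj J i j → Q i → InMonoCopy H χ (f i) (f j)
    extend⇒InMonoCopy {i} {j} i~j q =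
      c , insertAt g v w
        , insert-copy H v (colourClass χ c) (g-injective , λ _ _ → g-adj) (λ j → proj₁ (w~g j)) (λ j _ → w~g j)
        , punchIn v i , punchIn v j , i~j
        , trans (insertAt-punchIn g v w i) (g-f q) , trans (insertAt-punchIn g v w j) (g-f (closed i~j q))

  -- Copies of `J` that avoid deleted edges

  N : Fin n → Fin n → Set
  N = Edge xs

  N⇒≢ : ∀ {x y} → N x y → x ≢ y
  N⇒≢ (inj₁ xy) = proj₁ (proj₂ (nim _ _ xy))
  N⇒≢ (inj₂ yx) = ≢-sym (proj₁ (proj₂ (nim _ _ yx)))

  N⇒¬InMonoCopy : ∀ {x y} → N x y → ¬ InMonoCopy H χ x y
  N⇒¬InMonoCopy = edge⇒¬InMonoCopy H χ nim

  -- `B w` lists the ends of the edges deleted at `w`. A set contained in every `B w` is in effect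
  -- deleted as a set of vertices, though isolated vertices of `J` may still be mapped into it.
  record AvoidingCopy (B : Fin n → List (Fin n)) (f : Fin k → Fin n) : Set where
    field
      injective : Injective _≡_ _≡_ f
      edge      : ∀ {i j} → Adj J i j → N (f i) (f j)
      avoid     : ∀ {i j} → Adj J i j → f j ∉ B (f i)
  open AvoidingCopy

  weaken : ∀ {B B′ f} → (∀ w {u} → u ∈ B w → u ∈ B′ w) → AvoidingCopy B′ f → AvoidingCopy B f
  weaken B⊆B′ copy = record { injective = injective copy ; edge = edge copy ; avoid = λ i~j → avoid copy i~j ∘ B⊆B′ _ }

  avoids : ∀ {B R f} → (∀ w {u} → u ∈ R → u ∈ B w) → AvoidingCopy B f → ∀ {i j} → Adj J i j → f i ∉ R
  avoids R⊆B copy i~j = avoid copy (adjSym J i~j) ∘ R⊆B _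

  module _ (c : Bool) (S : List (Fin n)) where

    open import Data.List.Membership.DecPropositional (Fin._≟_ {n}) using (_∉?_)

    IsBad : Fin n → Fin n → Set
    IsBad w u = N w u × col χ w u ≡ c × w ∉ S × u ∉ S × h ≤ deg c S u

    isBad? : ∀ w → Decidable (IsBad w)
    isBad? w u = edge? xs w u ×-dec (col χ w u Bool.≟ c) ×-dec (w ∉? S) ×-dec (u ∉? S) ×-dec (h ≤? deg c S u)

    bad : Fin n → List (Fin n)
    bad w = filter (isBad? w) (allFin n)

    ∈-bad⁺ : ∀ {w u} → IsBad w u → u ∈ bad w
    ∈-bad⁺ {u = u} b = ∈-filter⁺ _ (∈-allFin u) b

    -- h + 1 bad neighbours of w with the same pattern on S, against h of their common neighbours in S and w.
    length-bad : ∀ {i j} → Adj H i j → Unique S → ∀ w → length (bad w) ≤ 2 ^ length S * suc h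
    length-bad i~j uS w with length (bad w) ≤? 2 ^ length S * suc h
    ... | yes le = le
    ... | no ≰ with equal-patterns (col χ) S (Unique.filter⁺ (isBad? w) (Unique.allFin⁺ n)) (<⇒≤ (≰⇒> ≰))
    ...   | u ∷ A , uA , sub , s≤s h≤A , agree =
      ⊥-elim (N⇒¬InMonoCopy (edge-sym (proj₁ (isBad (here refl))))
        (biclique⇒InMonoCopy c h≤A (proj₂ (proj₂ (proj₂ (proj₂ (isBad (here refl)))))) uA (∷-unique w∉D uD) cross i~j))
      where
      is-c : Decidable (λ z → col χ u z ≡ c)
      is-c z = col χ u z Bool.≟ c
      D : List (Fin n)
      D = filter is-c S
      isBad : ∀ {u′} → u′ ∈ u ∷ A → IsBad w u′
      isBad = proj₂ ∘ ∈-filter⁻ (isBad? w) {xs = allFin n} ∘ sub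
      uD : Unique D
      uD = Unique.filter⁺ is-c uS
      w∉D : w ∉ D
      w∉D w∈D = proj₁ (proj₂ (proj₂ (isBad (here refl)))) (proj₁ (∈-filter⁻ is-c w∈D))
      cross : ∀ {x y} → x ∈ u ∷ A → y ∈ w ∷ D → Mono c x y
      cross x∈ (here refl) = let nwx , e , _ = isBad x∈ in mono-sym (N⇒≢ nwx , e)
      cross x∈ (there y∈D) = let y∈S , e = ∈-filter⁻ is-c y∈D
                                 _ , _ , _ , x∉S , _ = isBad x∈
                             in (λ { refl → x∉S y∈S }) , trans (agree x∈ (here refl) y∈S) e

  AllEdges : Bool → (Fin n → List (Fin n)) → Set
  AllEdges c B = ∀ {f} → AvoidingCopy B f → ∀ {i j} → Adj J i j → col χ (f i) (f j) ≡ c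

  module _ {j₁ j₂ : Fin k} (j₁~j₂ : Adj J j₁ j₂) where

    -- A vertex with few c-neighbours has them all in B; otherwise they serve for the isolated vertices of J.
    other-colour-to-copy : ∀ {c y B f} → (∀ w {u} → u ∈ y ∷ take k (nbs c y) → u ∈ B w) → AvoidingCopy B f →
      (∀ {i j} → Adj J i j → col χ (f i) (f j) ≡ c) → ∃₂ λ i j → Adj J i j × col χ y (f i) ≡ not c
    other-colour-to-copy {c} {y} {B} {f} R⊆B copy all-c
      with Fin.any? (λ i → Fin.any? (λ j → J? i j ×-dec (col χ y (f i) Bool.≟ not c)))
    ... | yes hit = hit
    ... | no ¬hit with k ≤? length (nbs c y)
    ...   | yes k≤ = ⊥-elim (N⇒¬InMonoCopy (edge copy j₁~j₂)
        (extend⇒InMonoCopy c y f (injective copy) (λ i → Fin.any? (J? i))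
          (λ i~j _ → _ , adjSym J i~j)
          (λ i~j _ → N⇒≢ (edge copy i~j) , all-c i~j)
          (λ (_ , i~j) → y~f i~j)
          (take k (nbs c y)) (≤-reflexive (sym (length-take-≡ (nbs c y) k≤))) (Unique.take⁺ k (nbs-unique c y))
          (∈-nbs⁻ ∘ ∈-take⁻ k _)
          (λ (_ , i~j) → avoids (λ w → R⊆B w ∘ there) copy i~j)
          (λ i~j ¬Qi _ → contradiction (_ , i~j) ¬Qi)
          j₁~j₂ (_ , j₁~j₂)))
      where
      y~f : ∀ {i j} → Adj J i j → Mono c y (f i)
      y~f i~j = (λ y≡fi → avoids R⊆B copy i~j (here (sym y≡fi)))
              , [ id , (λ e → contradiction (_ , _ , i~j , e) ¬hit) ]′ (≡⊎≡not _ c)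
    ...   | no k≰ = contradiction
        (subst (f j₁ ∈_) (sym (take-all k (nbs c y) (<⇒≤ (≰⇒> k≰)))) (∈-nbs⁺ y~f))
        (avoids (λ w → R⊆B w ∘ there) copy j₁~j₂)
      where
      y~f : Mono c y (f j₁)
      y~f = (λ y≡fi → avoids R⊆B copy j₁~j₂ (here (sym y≡fi)))
          , [ id , (λ e → contradiction (_ , _ , j₁~j₂ , e) ¬hit) ]′ (≡⊎≡not _ c)

    -- `s` is the size of the clique `S` and of the set `Z`, `P` is the bound of `length-bad` for a
    -- set of that size, and `cost` bounds the further deletions per vertex once all copies have one
    -- colour.
    s P cost : ℕ
    s = h + h
    P = 2 ^ s * suc h
    cost = P + P + s + suc h

    -- Copies result from refuting `J`-freeness, hence the double negation. It costs nothing, since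
    -- the arguments using them end in `⊥`.
    module _ {K : ℕ} (extract : ∀ B → (∀ w → length (B w) ≤ K) → ¬ ¬ ∃ (AvoidingCopy B)) where

      extract-with : ∀ (B₀ : Fin n → List (Fin n)) {d₀} → (∀ w → length (B₀ w) ≤ d₀) →
        ∀ (B₁ : Fin n → List (Fin n)) {d₁} → (∀ w → length (B₁ w) ≤ d₁) → d₀ + d₁ ≤ K →
        ¬ ¬ ∃ (AvoidingCopy (λ w → B₀ w ++ B₁ w))
      extract-with B₀ l₀ B₁ l₁ ≤K = extract (λ w → B₀ w ++ B₁ w)
        (λ w → ≤-trans (≤-reflexive (length-++ (B₀ w))) (≤-trans (+-mono-≤ (l₀ w) (l₁ w)) ≤K))

      -- Copies of one colour against a NIM-edge of the other

      module _ (c : Bool) {x y : Fin n} (nxy : N x y) (xy-not-c : col χ x y ≡ not c)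
               (B₀ : Fin n → List (Fin n)) {d₀ : ℕ} (l₀ : ∀ w → length (B₀ w) ≤ d₀) (d₀≤ : d₀ + cost ≤ K)
               (all-c : AllEdges c B₀) where

        private
          -- Here `x` may have too few neighbours of the other colour to form `Z`. They can all be
          -- deleted, but `other-colour-to-copy` at `x` finds one of them in the next copy.
          module Few (few : length (nbs (not c) x) ≤ s) where

            R : List (Fin n)
            R = (x ∷ take k (nbs c x)) ++ nbs (not c) x

            length-R : length R ≤ cost
            length-R = begin
              length R                                      ≡⟨ length-++ (x ∷ take k (nbs c x)) ⟩
              suc (length (take k (nbs c x))) + length (nbs (not c) x)
                                                            ≤⟨ +-mono-≤ (s≤s (length-take-≤ k _)) few ⟩
              h + s                                         ≡⟨ +-comm h s ⟩
              s + h                                         ≤⟨ +-mono-≤ (m≤n+m s (P + P)) (n≤1+n h) ⟩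
              cost                                          ∎
              where open ≤-Reasoning

            absurd : ⊥
            absurd = extract-with B₀ l₀ (λ _ → R) (λ _ → length-R) d₀≤ λ (f , copy) →
              let all-c′ = all-c (weaken (λ _ → ∈-++⁺ˡ) copy)
                  i , j , i~j , e = other-colour-to-copy (λ w → ∈-++⁺ʳ (B₀ w) ∘ ∈-++⁺ˡ) copy all-c′
                  fi∉R = avoids (λ w → ∈-++⁺ʳ (B₀ w)) copy i~j
              in fi∉R (∈-++⁺ʳ (x ∷ take k (nbs c x)) (∈-nbs⁺ (∈∧∉⇒≢ (here refl) fi∉R , e)))

          module Many (many : s < length (nbs (not c) x)) where

            open ≤-Reasoning

            ≢y? : Decidable (λ z → y ≢ z)
            ≢y? z = ¬? (y Fin.≟ z)

            -- `y` is itself such a neighbour of `x`, but it will join `Z` on one side of the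
            -- biclique and must not be repeated there. The strict bound in `many` pays for its
            -- removal.
            Z⁺ Z : List (Fin n)
            Z⁺ = filter ≢y? (nbs (not c) x)
            Z = take s Z⁺

            Z-unique : Unique Z
            Z-unique = Unique.take⁺ s (Unique.filter⁺ ≢y? (nbs-unique (not c) x))

            length-Z : length Z ≡ s
            length-Z = length-take-≡ Z⁺ (s≤s⁻¹ (≤-trans many (unique-⊆⇒length≤ (nbs-unique (not c) x) cover)))
              where
              cover : ∀ {z} → z ∈ nbs (not c) x → z ∈ y ∷ Z⁺
              cover {z} z∈ with y Fin.≟ z
              ... | yes refl = here refl
              ... | no y≢z   = there (∈-filter⁺ ≢y? z∈ y≢z)

            x~Z : ∀ {z} → z ∈ Z → Mono (not c) x z
            x~Z = ∈-nbs⁻ ∘ proj₁ ∘ ∈-filter⁻ ≢y? ∘ ∈-take⁻ s Z⁺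

            y∉Z : y ∉ Z
            y∉Z y∈Z = proj₂ (∈-filter⁻ ≢y? {xs = nbs (not c) x} (∈-take⁻ s Z⁺ y∈Z)) refl

            Good : Fin n → Set
            Good d = d ∉ Z × x ≢ d × Mono (not c) y d × h ≤ deg (not c) Z d

            -- Splitting by patterns on `Z` leaves `h` of these vertices; `x` is the additional
            -- vertex on their side of the biclique.
            m : ℕ
            m = 2 ^ s * h

            m≤P : m ≤ P
            m≤P = *-monoʳ-≤ (2 ^ s) (n≤1+n h)

            -- Vertices with equal patterns share their at least `h` neighbours of colour `not c` in
            -- `Z`. Together with `x` they face these neighbours and `y`, a biclique through the
            -- NIM-edge `xy`.
            finish : ∀ ds → Unique ds → All Good ds → m ≤ length ds → ⊥
            finish ds u good m≤ with equal-patterns (col χ) Z u (subst (λ l → 2 ^ l * h ≤ length ds) (sym length-Z) m≤)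
            ... | d ∷ D , uD , sub , h≤D , agree = N⇒¬InMonoCopy nxy
              (biclique⇒InMonoCopy (not c) h≤D (proj₂ (proj₂ (proj₂ (good′ (here refl)))))
                (∷-unique (λ x∈ → proj₁ (proj₂ (good′ x∈)) refl) uD)
                (∷-unique (y∉Z ∘ proj₁ ∘ ∈-filter⁻ is-c̄) (Unique.filter⁺ is-c̄ Z-unique))
                cross j₁~j₂)
              where
              is-c̄ : Decidable (λ z → col χ d z ≡ not c)
              is-c̄ z = col χ d z Bool.≟ not c
              good′ : ∀ {u} → u ∈ d ∷ D → Good u
              good′ = All.lookup good ∘ sub
              cross : ∀ {p q} → p ∈ x ∷ d ∷ D → q ∈ y ∷ filter is-c̄ Z → Mono (not c) p q
              cross (here refl) (here refl) = N⇒≢ nxy , xy-not-c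
              cross (here refl) (there q∈)  = x~Z (proj₁ (∈-filter⁻ is-c̄ q∈))
              cross (there p∈)  (here refl) = mono-sym (proj₁ (proj₂ (proj₂ (good′ p∈))))
              cross (there p∈)  (there q∈)  =
                let q∈Z , e = ∈-filter⁻ is-c̄ q∈
                in ≢-sym (∈∧∉⇒≢ q∈Z (proj₁ (good′ p∈))) , trans (agree p∈ (here refl) q∈Z) e

            R : List (Fin n) → List (Fin n)
            -- The first part is what `other-colour-to-copy` requires; deleting `x`, `Z` and `ds`
            -- makes the vertex found next a new one.
            R ds = (y ∷ take k (nbs c y)) ++ x ∷ Z ++ ds

            length-R : ∀ ds → length ds ≤ P → length (R ds) ≤ P + s + suc h
            length-R ds ≤P = begin
              length (R ds)                                 ≡⟨ length-++ (y ∷ take k (nbs c y)) ⟩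
              suc (length (take k (nbs c y))) + suc (length (Z ++ ds))
                                                            ≡⟨ cong (λ l → suc (length (take k (nbs c y))) + suc l) (length-++ Z) ⟩
              suc (length (take k (nbs c y))) + suc (length Z + length ds)
                                                            ≤⟨ +-mono-≤ (s≤s (length-take-≤ k _)) (s≤s (+-mono-≤ (≤-reflexive length-Z) ≤P)) ⟩
              h + suc (s + P)                               ≡⟨ +-suc h (s + P) ⟩
              suc h + (s + P)                               ≡⟨ +-comm (suc h) (s + P) ⟩
              s + P + suc h                                 ≡⟨ cong (_+ suc h) (+-comm s P) ⟩
              P + s + suc h                                 ∎

            B₁ : List (Fin n) → Fin n → List (Fin n)
            B₁ ds w = bad c Z w ++ R ds

            length-B₁ : ∀ ds → length ds ≤ P → ∀ w → length (B₁ ds w) ≤ cost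
            length-B₁ ds ≤P w = begin
              length (B₁ ds w)                    ≡⟨ length-++ (bad c Z w) ⟩
              length (bad c Z w) + length (R ds)  ≤⟨ +-mono-≤ (length-bad c Z j₁~j₂ Z-unique w) (length-R ds ≤P) ⟩
              2 ^ length Z * suc h + (P + s + suc h)  ≡⟨ cong (λ l → 2 ^ l * suc h + (P + s + suc h)) length-Z ⟩
              P + (P + s + suc h)                 ≡⟨ +-assoc P (P + s) (suc h) ⟨
              P + (P + s) + suc h                 ≡⟨ cong (_+ suc h) (+-assoc P P s) ⟨
              cost                                ∎

            -- Each round takes from a fresh copy a vertex `f i` joined to `y` in colour `not c`. It
            -- ends a `c`-coloured edge of the copy that is not bad, so it has fewer than `h`
            -- `c`-neighbours among the `2h` vertices of `Z`.
            collect : ∀ r ds → Unique ds → All Good ds → r + length ds ≡ m → ⊥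
            collect zero    ds u good e = finish ds u good (≤-reflexive (sym e))
            collect (suc r) ds u good e =
              extract-with B₀ l₀ (B₁ ds) (length-B₁ ds (≤-trans (≤-trans (m≤n+m (length ds) (suc r)) (≤-reflexive e)) m≤P)) d₀≤
              step
              where
              step : ¬ ∃ (AvoidingCopy (λ w → B₀ w ++ B₁ ds w))
              step (f , copy) = collect r (f i ∷ ds) (∷-unique fi∉ds u)
                ((fi∉Z , ∈∧∉⇒≢ (here refl) fi∉xZds , (∈∧∉⇒≢ (here refl) fi∉yW , proj₂ (proj₂ (proj₂ hit))) , high) ∷ good)
                (trans (+-suc r (length ds)) e)
                where
                all-c′ : ∀ {i j} → Adj J i j → col χ (f i) (f j) ≡ c
                all-c′ = all-c (weaken (λ _ → ∈-++⁺ˡ) copy)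
                R⊆ : ∀ w {u} → u ∈ R ds → u ∈ B₀ w ++ B₁ ds w
                R⊆ w = ∈-++⁺ʳ (B₀ w) ∘ ∈-++⁺ʳ (bad c Z w)
                hit : ∃₂ λ i j → Adj J i j × col χ y (f i) ≡ not c
                hit = other-colour-to-copy (λ w → R⊆ w ∘ ∈-++⁺ˡ) copy all-c′
                i j : Fin k
                i = proj₁ hit
                j = proj₁ (proj₂ hit)
                j~i : Adj J j i
                j~i = adjSym J (proj₁ (proj₂ (proj₂ hit)))
                f∉R : ∀ {i j} → Adj J i j → f i ∉ R ds
                f∉R = avoids R⊆ copy
                fi∉yW : f i ∉ y ∷ take k (nbs c y)
                fi∉yW = proj₁ (∉-++ (y ∷ take k (nbs c y)) (f∉R (adjSym J j~i)))
                fi∉xZds : f i ∉ x ∷ Z ++ ds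
                fi∉xZds = proj₂ (∉-++ (y ∷ take k (nbs c y)) (f∉R (adjSym J j~i)))
                fi∉Z : f i ∉ Z
                fi∉Z = proj₁ (∉-++ Z (fi∉xZds ∘ there))
                fi∉ds : f i ∉ ds
                fi∉ds = proj₂ (∉-++ Z (fi∉xZds ∘ there))
                fj∉Z : f j ∉ Z
                fj∉Z = proj₁ (∉-++ Z (proj₂ (∉-++ (y ∷ take k (nbs c y)) (f∉R j~i)) ∘ there))
                low : ¬ (h ≤ deg c Z (f i))
                low h≤ =
                  avoid copy j~i (∈-++⁺ʳ (B₀ (f j)) (∈-++⁺ˡ (∈-bad⁺ c Z (edge copy j~i , all-c′ j~i , fj∉Z , fi∉Z , h≤))))
                high : h ≤ deg (not c) Z (f i)
                high = [ (λ h≤ → contradiction h≤ low) , id ]′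
                         (average (≤-trans (≤-reflexive (sym length-Z)) (deg-cover c Z (f i))))

            absurd : ⊥
            absurd = collect m [] [] [] (+-identityʳ m)

        one-colour-absurd : ⊥
        one-colour-absurd with length (nbs (not c) x) ≤? s
        ... | yes few = Few.absurd few
        ... | no many = Many.absurd (≰⇒> many)

      -- Reduction to copies of a single colour

      module _ (both : ∀ c → ∃₂ λ x y → N x y × col χ x y ≡ c)
               (c : Bool) (S : List (Fin n)) (S-clique : Clique c S) (length-S : length S ≡ s)
               -- In order: bad edges for a set `T` of at most `h * k` vertices, `T` itself, the
               -- deletions of `base`, and those of the one-colour argument.
               (≤K : 2 ^ (h * k) * suc h + h * k + (P + P + s) + cost ≤ K) where

        private

          open ≤-Reasoning

          c̄ : Bool
          c̄ = not c

          S-unique : Unique S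
          S-unique = AllPairs.map proj₁ S-clique

          -- Outside `bad`, each vertex sees a c-edge or a not-c-edge of the copy, but not both.
          base : Fin n → List (Fin n)
          base w = (bad c S w ++ bad c̄ S w) ++ S

          S⊆base : ∀ w {u} → u ∈ S → u ∈ base w
          S⊆base w = ∈-++⁺ʳ (bad c S w ++ bad c̄ S w)

          length-bad-S : ∀ b w → length (bad b S w) ≤ P
          length-bad-S b w = subst (λ l → length (bad b S w) ≤ 2 ^ l * suc h) length-S (length-bad b S j₁~j₂ S-unique w)

          length-base : ∀ w → length (base w) ≤ P + P + s
          length-base w = begin
            length (base w)                                       ≡⟨ length-++ (bad c S w ++ bad c̄ S w) ⟩
            length (bad c S w ++ bad c̄ S w) + length S            ≡⟨ cong (_+ length S) (length-++ (bad c S w)) ⟩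
            length (bad c S w) + length (bad c̄ S w) + length S    ≤⟨ +-mono-≤ (+-mono-≤ (length-bad-S c w) (length-bad-S c̄ w)) (≤-reflexive length-S) ⟩
            P + P + s                                             ∎

          low : ∀ {f} → AvoidingCopy base f → ∀ b → (∀ w {u} → u ∈ bad b S w → u ∈ base w) →
            ∀ {i j} → Adj J i j → col χ (f i) (f j) ≡ b → ¬ (h ≤ deg b S (f i))
          low copy b bad⊆ {i} {j} i~j e h≤ =
            avoid copy (adjSym J i~j) (bad⊆ _ (∈-bad⁺ b S (edge copy (adjSym J i~j) , trans (colSym χ _ _) e
              , avoids S⊆base copy (adjSym J i~j) , avoids S⊆base copy i~j , h≤)))

          low-c : ∀ {f} → AvoidingCopy base f → ∀ {i j} → Adj J i j → col χ (f i) (f j) ≡ c → ¬ (h ≤ deg c S (f i))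
          low-c copy = low copy c (λ _ → ∈-++⁺ˡ ∘ ∈-++⁺ˡ)

          low-c̄ : ∀ {f} → AvoidingCopy base f → ∀ {i j} → Adj J i j → col χ (f i) (f j) ≡ c̄ → ¬ (h ≤ deg c̄ S (f i))
          low-c̄ copy = low copy c̄ (λ w → ∈-++⁺ˡ ∘ ∈-++⁺ʳ (bad c S w))

          high : ∀ w → h ≤ deg c S w ⊎ h ≤ deg c̄ S w
          high w = average (≤-trans (≤-reflexive (sym length-S)) (deg-cover c S w))

          -- `T` collects the `c`-coloured parts of `i` disjoint copies. Each part adds one to
          -- `T-deg`, and at `i = h` the vertices concerned reach the degree that `IsBad` asks for.
          record Stage (i : ℕ) : Set where
            field
              T        : List (Fin n)
              T-unique : Unique T
              length-T : length T ≤ i * k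
              T-deg    : ∀ {p} → p ∉ T → p ∉ S → h ≤ deg c S p → i ≤ deg c̄ T p

          module Enlarge {i : ℕ} (st : Stage i) {f : Fin k → Fin n} (copy : AvoidingCopy (λ w → base w ++ Stage.T st) f)
                   {i₁ i₂ : Fin k} (i₁~i₂ : Adj J i₁ i₂) (i₁i₂-c : col χ (f i₁) (f i₂) ≡ c) where

            open Stage st

            -- By `Q-coloured` every edge of the copy at such a vertex has colour `c`, so `Q` is a
            -- union of components of `J`.
            Q : Fin k → Set
            Q a = ∃ λ b → Adj J a b × col χ (f a) (f b) ≡ c

            Q? : Decidable Q
            Q? a = Fin.any? (λ b → J? a b ×-dec (col χ (f a) (f b) Bool.≟ c))

            base-copy : AvoidingCopy base f
            base-copy = weaken (λ _ → ∈-++⁺ˡ) copy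

            Q-coloured : ∀ {a b} → Adj J a b → Q a → col χ (f a) (f b) ≡ c
            Q-coloured {a} a~b (b′ , a~b′ , e) = [ id , (λ e′ → ⊥-elim
              ([ low-c base-copy a~b′ e , low-c̄ base-copy a~b e′ ]′ (high (f a)))) ]′ (≡⊎≡not _ c)

            F T′ : List (Fin n)
            F = map f (filter Q? (allFin k))
            T′ = F ++ T

            ∈-F⁺ : ∀ {a} → Q a → f a ∈ F
            ∈-F⁺ {a} q = ∈-map⁺ f (∈-filter⁺ Q? (∈-allFin a) q)

            ∈-F⁻ : ∀ {p} → p ∈ F → ∃ λ a → p ≡ f a × Q a
            ∈-F⁻ p∈F = let a , a∈ , e = ∈-map⁻ f p∈F in a , e , proj₂ (∈-filter⁻ Q? {xs = allFin k} a∈)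

            avoids-T : ∀ {a} → Q a → f a ∉ T
            avoids-T (_ , a~b , _) = avoids (λ w → ∈-++⁺ʳ (base w)) copy a~b

            avoids-S : ∀ {a} → Q a → f a ∉ S
            avoids-S (_ , a~b , _) = avoids S⊆base base-copy a~b

            -- If `p` were joined to all of `F` in colour `c`, it could play `v`, with its
            -- `c`-neighbours in the clique `S` replacing the vertices outside `Q`. This would be a
            -- `c`-coloured `H` through the NIM-edge from `f i₁` to `f i₂`.
            F-deg : ∀ {p} → p ∉ F → p ∉ S → h ≤ deg c S p → 1 ≤ deg c̄ F p
            F-deg {p} p∉F p∉S h≤ with Fin.any? (λ a → Q? a ×-dec (col χ p (f a) Bool.≟ c̄))
            ... | yes (a , q , e) = ∈-length (∈-filter⁺ (λ z → col χ p z Bool.≟ c̄) (∈-F⁺ q) e)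
            ... | no ¬hit = ⊥-elim (N⇒¬InMonoCopy (edge copy i₁~i₂)
              (extend⇒InMonoCopy c p f (injective copy) Q?
                (λ a~b q → _ , adjSym J a~b , trans (colSym χ _ _) (Q-coloured a~b q))
                (λ a~b q → N⇒≢ (edge copy a~b) , Q-coloured a~b q)
                (λ q → ≢-sym (∈∧∉⇒≢ (∈-F⁺ q) p∉F) , [ id , (λ e → contradiction (_ , q , e) ¬hit) ]′ (≡⊎≡not _ c))
                (filter is-c S) (≤-trans (n≤1+n k) h≤) (Unique.filter⁺ is-c S-unique)
                (λ z∈ → let z∈S , e = ∈-filter⁻ is-c z∈ in ≢-sym (∈∧∉⇒≢ z∈S p∉S) , e)
                (λ q → avoids-S q ∘ proj₁ ∘ ∈-filter⁻ is-c)
                (λ _ _ _ → AllPairs.filter⁺ is-c S-clique)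
                i₁~i₂ (i₂ , i₁~i₂ , i₁i₂-c)))
              where
              is-c : Decidable (λ z → col χ p z ≡ c)
              is-c z = col χ p z Bool.≟ c

            next : Stage (suc i)
            next = record
              { T        = T′
              ; T-unique = Unique.++⁺ (Unique.map⁺ (injective copy) (Unique.filter⁺ Q? (Unique.allFin⁺ k))) T-unique
                  (λ (p∈F , p∈T) → let a , e , q = ∈-F⁻ p∈F in avoids-T q (subst (_∈ T) e p∈T))
              ; length-T = begin
                  length T′                                ≡⟨ length-++ F ⟩
                  length F + length T                      ≡⟨ cong (_+ length T) (length-map f (filter Q? (allFin k))) ⟩
                  length (filter Q? (allFin k)) + length T ≤⟨ +-mono-≤ (length-filter Q? (allFin k)) length-T ⟩
                  length (allFin k) + i * k                ≡⟨ cong (_+ i * k) (length-tabulate id) ⟩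
                  suc i * k                                ∎
              ; T-deg    = λ {p} p∉T′ p∉S h≤ → let p∉F , p∉T = ∉-++ F p∉T′ in
                  ≤-trans (+-mono-≤ (F-deg p∉F p∉S h≤) (T-deg p∉T p∉S h≤)) (≤-reflexive (sym (deg-++ c̄ F T p)))
              }

          -- An end of an edge of colour `c̄` in a remaining copy has few `c̄`-neighbours in `S`,
          -- hence many `c`-neighbours there, and by `T-deg` at least `h` `c̄`-neighbours in `T`.
          -- The edge is then bad for `T`, and `B` excludes it.
          last-stage : Stage h → ⊥
          last-stage st = one-colour-absurd c nxy xy-c̄ B length-B ≤K all-c
            where
            open Stage st
            x = proj₁ (both c̄)
            y = proj₁ (proj₂ (both c̄))
            nxy = proj₁ (proj₂ (proj₂ (both c̄)))
            xy-c̄ = proj₂ (proj₂ (proj₂ (both c̄)))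
            B : Fin n → List (Fin n)
            B w = (bad c̄ T w ++ T) ++ base w
            length-B : ∀ w → length (B w) ≤ 2 ^ (h * k) * suc h + h * k + (P + P + s)
            length-B w = begin
              length (B w)                                         ≡⟨ length-++ (bad c̄ T w ++ T) ⟩
              length (bad c̄ T w ++ T) + length (base w)            ≡⟨ cong (_+ length (base w)) (length-++ (bad c̄ T w)) ⟩
              length (bad c̄ T w) + length T + length (base w)      ≤⟨ +-mono-≤ (+-mono-≤ (≤-trans (length-bad c̄ T j₁~j₂ T-unique w)
                                                                        (*-monoˡ-≤ (suc h) (^-monoʳ-≤ 2 length-T))) length-T) (length-base w) ⟩
              2 ^ (h * k) * suc h + h * k + (P + P + s)            ∎
            all-c : AllEdges c B
            all-c {f} copy {a} {b} a~b = [ id , (λ e → contradiction (fa-bad e) (avoid copy (adjSym J a~b))) ]′ (≡⊎≡not _ c)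
              where
              base-copy : AvoidingCopy base f
              base-copy = weaken (λ w → ∈-++⁺ʳ (bad c̄ T w ++ T)) copy
              avoids-T : ∀ {a b} → Adj J a b → f a ∉ T
              avoids-T = avoids (λ w → ∈-++⁺ˡ ∘ ∈-++⁺ʳ (bad c̄ T w)) copy
              avoids-S : f a ∉ S
              avoids-S = avoids S⊆base base-copy a~b
              fa-bad : col χ (f a) (f b) ≡ c̄ → f a ∈ B (f b)
              fa-bad e = ∈-++⁺ˡ (∈-++⁺ˡ (∈-bad⁺ c̄ T (edge copy (adjSym J a~b) , trans (colSym χ _ _) e , avoids-T (adjSym J a~b) , avoids-T a~b
                , T-deg (avoids-T a~b) avoids-S
                    ([ id , (λ h≤ → contradiction h≤ (low-c̄ base-copy a~b e)) ]′ (high (f a))))))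

          -- Either some copy left over has a c-edge and enlarges T, or all of them have colour not c.
          stages : ∀ r {i} → r + i ≡ h → Stage i → ⊥
          stages zero    refl st = last-stage st
          stages (suc r) {i} e st = one-colour-absurd c̄ nxy xy-c B length-B ≤K′ all-c̄
            where
            open Stage st
            x = proj₁ (both c)
            y = proj₁ (proj₂ (both c))
            nxy = proj₁ (proj₂ (proj₂ (both c)))
            xy-c : col χ x y ≡ not c̄
            xy-c = trans (proj₂ (proj₂ (proj₂ (both c)))) (sym (Bool.not-involutive c))
            B : Fin n → List (Fin n)
            B w = base w ++ T
            i≤h : i ≤ h
            i≤h = ≤-trans (m≤n+m i (suc r)) (≤-reflexive e)
            length-B : ∀ w → length (B w) ≤ P + P + s + h * k
            length-B w = ≤-trans (≤-reflexive (length-++ (base w)))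
              (+-mono-≤ (length-base w) (≤-trans length-T (*-monoˡ-≤ k i≤h)))
            ≤K′ : P + P + s + h * k + cost ≤ K
            ≤K′ = ≤-trans (+-monoˡ-≤ cost (≤-trans (≤-reflexive (+-comm (P + P + s) (h * k)))
              (+-monoˡ-≤ (P + P + s) (m≤n+m (h * k) (2 ^ (h * k) * suc h))))) ≤K
            all-c̄ : AllEdges c̄ B
            all-c̄ copy a~b = [ (λ e′ → ⊥-elim (stages r (trans (+-suc r i) e) (Enlarge.next st copy a~b e′))) , id ]′ (≡⊎≡not _ c)

        two-colours-absurd : ⊥
        two-colours-absurd = stages h (+-identityʳ h)
          (record { T = [] ; T-unique = [] ; length-T = z≤n ; T-deg = λ _ _ _ → z≤n })

    -- Bounding the number of deletions

    budget : ℕ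
    budget = 2 ^ (h * k) * suc h + h * k + (P + P + s) + cost

    k≥2 : 2 ≤ k
    k≥2 = Fin-≥2 λ j₁≡j₂ → irrefl J (subst (Adj J j₁) (sym j₁≡j₂) j₁~j₂)
      where
      Fin-≥2 : ∀ {m} {i j : Fin m} → i ≢ j → 2 ≤ m
      Fin-≥2 {suc zero}    {zero} {zero} i≢j = contradiction refl i≢j
      Fin-≥2 {suc (suc m)} _ = s≤s (s≤s z≤n)

    -- The budget has nine summands, each at most `M`. As `J` has an edge, `h` is at least 3, so
    -- twice nine is below 2^5 and hence at most a second factor `M`.
    budget-bound : budget + budget ≤ 2 ^ (2 * (h * h))
    budget-bound = begin
      budget + budget                             ≤⟨ +-mono-≤ budget≤ budget≤ ⟩
      nine + nine                                 ≡⟨ solve 1 (λ m → let n = m :+ m :+ (m :+ m :+ m) :+ (m :+ m :+ m :+ m)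
                                                                  in n :+ n := con 18 :* m) refl M ⟩
      18 * M                                      ≤⟨ *-monoˡ-≤ M (≤-trans (m≤m+n 18 14) (^-monoʳ-≤ 2 5≤hh)) ⟩
      M * M                                       ≡⟨ ^-distribˡ-+-* 2 (h * h) (h * h) ⟨
      2 ^ (h * h + h * h)                         ≡⟨ cong (λ m → 2 ^ (h * h + m)) (+-identityʳ (h * h)) ⟨
      2 ^ (2 * (h * h))                           ∎
      where
      open ≤-Reasoning
      open import Data.Nat.Solver using (module +-*-Solver)
      open +-*-Solver using (solve; _:+_; _:*_; _:=_; con)
      M nine : ℕ
      M = 2 ^ (h * h)
      nine = M + M + (M + M + M) + (M + M + M + M)
      3h≤hh : 3 * h ≤ h * h
      3h≤hh = *-monoˡ-≤ h (s≤s k≥2)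
      5≤hh : 5 ≤ h * h
      5≤hh = ≤-trans (≤-trans (m≤m+n 5 4) (*-monoʳ-≤ 3 (s≤s k≥2))) 3h≤hh
      m<2^m : ∀ m → m < 2 ^ m
      m<2^m zero    = s≤s z≤n
      m<2^m (suc m) = ≤-trans (+-mono-≤ (m^n>0 2 m) (m<2^m m)) (≤-reflexive (cong (2 ^ m +_) (sym (+-identityʳ _))))
      hh≤M : h * h ≤ M
      hh≤M = <⇒≤ (m<2^m (h * h))
      s≤hh : s ≤ h * h
      s≤hh = ≤-trans (+-monoʳ-≤ h (m≤m+n h (h + 0))) 3h≤hh
      power : ∀ m → m + h ≤ h * h → 2 ^ m * suc h ≤ M
      power m m+h≤ = begin
        2 ^ m * suc h   ≤⟨ *-monoʳ-≤ (2 ^ m) (m<2^m h) ⟩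
        2 ^ m * 2 ^ h   ≡⟨ ^-distribˡ-+-* 2 m h ⟨
        2 ^ (m + h)     ≤⟨ ^-monoʳ-≤ 2 m+h≤ ⟩
        M               ∎
      P≤M : P ≤ M
      P≤M = power s (≤-trans (≤-reflexive (solve 1 (λ m → m :+ m :+ m := con 3 :* m) refl h)) 3h≤hh)
      suc-h≤M : suc h ≤ M
      suc-h≤M = ≤-trans (m<2^m h) (^-monoʳ-≤ 2 (m≤n*m h h))
      budget≤ : budget ≤ nine
      budget≤ = +-mono-≤ (+-mono-≤ (+-mono-≤ (power (h * k) (≤-reflexive (trans (+-comm (h * k) h) (sym (*-suc h k)))))
                                             (≤-trans (*-monoʳ-≤ h (n≤1+n k)) hh≤M))
                                   (+-mono-≤ (+-mono-≤ P≤M P≤M) (≤-trans s≤hh hh≤M)))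
                         (+-mono-≤ (+-mono-≤ (+-mono-≤ P≤M P≤M) (≤-trans s≤hh hh≤M)) suc-h≤M)

    -- Edge counts that force copies of `J`

    module _ (xs-unique : Unique xs) {a : ℕ} (ex-J : ∀ (G : Graph n) m → HFree G J → NumEdges G m → m ≤ a) where

      ordered : Ordered xs
      ordered xy = proj₁ (nim _ _ xy)

      -- A deleted pair is charged to the end whose list contains the other end. This may be the
      -- smaller or the larger one, so `E` and its reversal are both counted; the pairs left over
      -- exceed the extremal number of `J`.
      many-edges⇒copy : ∀ {d} → a + (n * d + n * d) < length xs →
        ∀ B → (∀ w → length (B w) ≤ d) → ¬ ¬ ∃ (AvoidingCopy B)
      many-edges⇒copy {d} many B length-B ¬copy = <⇒≱ many (begin
        length xs                      ≤⟨ length-filter-cover avoiding? meeting? cover xs ⟩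
        length kept-xs + length (filter meeting? xs)
                                       ≤⟨ +-mono-≤ (ex-J (edgeGraph kept-xs kept-ordered) (length kept-xs) J-free
                                                     (edgeGraph-NumEdges kept-ordered (Unique.filter⁺ avoiding? xs-unique)))
                                                   (unique-⊆⇒length≤ (Unique.filter⁺ meeting? xs-unique) dropped-⊆) ⟩
        a + length (E ++ map swap E)   ≡⟨ cong (a +_) (length-++ E) ⟩
        a + (length E + length (map swap E)) ≡⟨ cong (λ m → a + (length E + m)) (length-map swap E) ⟩
        a + (length E + length E)      ≤⟨ +-monoʳ-≤ a (+-mono-≤ length-E length-E) ⟩
        a + (n * d + n * d)            ∎)
        where
        open ≤-Reasoning
        open import Data.List.Membership.DecPropositional (Fin._≟_ {n}) using (_∈?_)
        Meeting Avoiding : Fin n × Fin n → Set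
        Meeting (x , y) = y ∈ B x ⊎ x ∈ B y
        Avoiding e = ¬ Meeting e
        meeting? : Decidable Meeting
        meeting? (x , y) = (y ∈? B x) ⊎-dec (x ∈? B y)
        avoiding? : Decidable Avoiding
        avoiding? e = ¬? (meeting? e)
        cover : ∀ e → Avoiding e ⊎ Meeting e
        cover e with meeting? e
        ... | yes m = inj₂ m
        ... | no ¬m = inj₁ ¬m
        kept-xs E : List (Fin n × Fin n)
        kept-xs = filter avoiding? xs
        E = concatMap (λ w → map (w ,_) (B w)) (allFin n)
        kept-ordered : Ordered kept-xs
        kept-ordered = ordered ∘ proj₁ ∘ ∈-filter⁻ avoiding?
        kept⁻ : ∀ {x y} → Edge kept-xs x y → N x y × y ∉ B x
        kept⁻ (inj₁ xy) = let xy∈ , av = ∈-filter⁻ avoiding? xy in inj₁ xy∈ , av ∘ inj₁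
        kept⁻ (inj₂ yx) = let yx∈ , av = ∈-filter⁻ avoiding? yx in inj₂ yx∈ , av ∘ inj₂
        J-free : HFree (edgeGraph kept-xs kept-ordered) J
        J-free (f , f-injective , adj) = ¬copy (f , record
          { injective = f-injective
          ; edge      = λ i~j → proj₁ (kept⁻ (adj _ _ i~j))
          ; avoid     = λ i~j → proj₂ (kept⁻ (adj _ _ i~j))
          })
        ∈-E : ∀ {x y} → y ∈ B x → (x , y) ∈ E
        ∈-E {x} y∈ = ∈-concatMap⁺ (λ w → map (w ,_) (B w)) (lose (∈-allFin x) (∈-map⁺ (x ,_) y∈))
        dropped-⊆ : ∀ {e} → e ∈ filter meeting? xs → e ∈ E ++ map swap E
        dropped-⊆ e∈ with proj₂ (∈-filter⁻ meeting? {xs = xs} e∈)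
        ... | inj₁ y∈ = ∈-++⁺ˡ (∈-E y∈)
        ... | inj₂ x∈ = ∈-++⁺ʳ E (∈-map⁺ swap (∈-E x∈))
        length-E : length E ≤ n * d
        length-E = ≤-trans (length-concatMap≤ _ (λ w → ≤-trans (≤-reflexive (length-map (w ,_) (B w))) (length-B w)) (allFin n))
                           (≤-reflexive (cong (_* d) (length-tabulate {n = n} id)))

      two-colours-bound : (∀ c → ∃₂ λ x y → N x y × col χ x y ≡ c) → 2 ^ (s + s) ≤ n →
        length xs ≤ a + 2 ^ (2 * (h * h)) * n
      two-colours-bound both n-large with length xs ≤? a + (n * budget + n * budget)
      ... | yes le = begin
        length xs                                ≤⟨ le ⟩
        a + (n * budget + n * budget)            ≡⟨ cong (a +_) (*-distribˡ-+ n budget budget) ⟨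
        a + n * (budget + budget)                ≤⟨ +-monoʳ-≤ a (*-monoʳ-≤ n budget-bound) ⟩
        a + n * 2 ^ (2 * (h * h))                ≡⟨ cong (a +_) (*-comm n _) ⟩
        a + 2 ^ (2 * (h * h)) * n                ∎
        where open ≤-Reasoning
      ... | no many = ⊥-elim ([ with-clique true , with-clique false ]′
              (ramsey s s (Unique.allFin⁺ n) (≤-trans n-large (≤-reflexive (sym (length-tabulate id))))))
        where
        with-clique : ∀ c → (∃ λ S → Clique c S × length S ≡ s × (∀ {z} → z ∈ S → z ∈ allFin n)) → ⊥
        with-clique c (S , S-clique , length-S , _) =
          two-colours-absurd (many-edges⇒copy (≰⇒> many)) both c S S-clique length-S ≤-refl

-- Extremal colourings

same-colour? : ∀ {n} (χ : Colouring n) (xs : List (Fin n × Fin n)) →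
  (∃ λ c → ∀ {x y} → (x , y) ∈ xs → col χ x y ≡ c) ⊎ (∀ c → ∃₂ λ x y → Edge xs x y × col χ x y ≡ c)
same-colour? χ xs with Any.any? (has true) xs | Any.any? (has false) xs
  where
  has : ∀ c e → Dec (col χ (proj₁ e) (proj₂ e) ≡ c)
  has c (x , y) = col χ x y Bool.≟ c
... | no ¬t | _     = inj₁ (false , λ xy → Bool.¬-not (λ e → ¬t (lose xy e)))
... | yes _ | no ¬f = inj₁ (true , λ xy → Bool.¬-not (λ e → ¬f (lose xy e)))
... | yes t | yes f = inj₂ λ { true → with-colour t ; false → with-colour f }
  where
  with-colour : ∀ {c} → Any.Any (λ e → col χ (proj₁ e) (proj₂ e) ≡ c) xs → ∃₂ λ x y → Edge xs x y × col χ x y ≡ c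
  with-colour p = let (x , y) , xy , e = find p in x , y , inj₁ xy , e

module _ {n k : ℕ} (H : Graph (suc k)) (v : Fin (suc k)) (bipartite : Bipartite H) {a b : ℕ}
         (ex-J : IsEx n (deleteVertex H v) a) (ex-H : IsEx n H b)
         (gap : a + 2 ^ (2 * (suc k * suc k)) * n < b) (k<n : k < n)
         (n-large : 2 ^ (suc k + suc k + (suc k + suc k)) ≤ n) where

  private
    J : Graph k
    J = deleteVertex H v

  -- Without edges, `J` would embed in every graph on `n > k` vertices, including the `J`-free one
  -- supplied by `ex-J`.
  J-has-edge : ¬ ¬ (∃₂ λ i j → Adj J i j)
  J-has-edge ¬edge = let (G , J-free , _) , _ = ex-J in
    J-free ((λ i → inject≤ i (<⇒≤ k<n)) , Fin.inject≤-injective _ _ _ _ , λ i j i~j → ⊥-elim (¬edge (i , j , i~j)))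

  free-vertex : (f : Fin k → Fin n) → ∃ λ w → ∀ i → w ≢ f i
  free-vertex f with Fin.any? (λ w → Fin.all? (λ i → ¬? (w Fin.≟ f i)))
  ... | yes free = free
  ... | no ¬free = contradiction k<n (≤⇒≯ (begin
    n                           ≡⟨ length-tabulate {n = n} id ⟨
    length (allFin n)           ≤⟨ unique-⊆⇒length≤ (Unique.allFin⁺ n) (λ {w} _ → covered w) ⟩
    length (map f (allFin k))   ≡⟨ length-map f (allFin k) ⟩
    length (allFin k)           ≡⟨ length-tabulate {n = k} id ⟩
    k                           ∎))
    where
    open ≤-Reasoning
    covered : ∀ w → w ∈ map f (allFin k)
    covered w with Fin.any? (λ i → w Fin.≟ f i)
    ... | yes (i , refl) = ∈-map⁺ f (∈-allFin i)
    ... | no ¬hit        = contradiction (w , λ i e → ¬hit (i , e)) ¬free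

  v-has-neighbour : ¬ ¬ (∃ λ u → Adj H v u)
  v-has-neighbour isolated with proj₁ ex-H
  ... | G , H-free , G-count = <⇒≱ (≤-<-trans (m≤m+n a _) gap) (proj₂ ex-J G b J-free G-count)
    where
    J-free : HFree G J
    J-free (f , copy) = let w , w≢f = free-vertex f in
      H-free (_ , insert-copy H v G copy w≢f (λ j v~j → ⊥-elim (isolated (_ , v~j))))

  -- The inequality is decidable, hence stable, so an edge of `J` and decisions for the adjacency of
  -- `H` may be assumed.
  two-colours< : (χ : Colouring n) {xs : List (Fin n × Fin n)} → Unique xs → AllNIM H χ xs →
    (∀ c → ∃₂ λ x y → Edge xs x y × col χ x y ≡ c) → length xs < b
  two-colours< χ {xs} u nim both = decidable-stable (length xs <? b) λ ¬< →
    J-has-edge λ (_ , _ , j₁~j₂) →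
    ¬¬-finite (λ i → ¬¬-finite (λ j → ¬¬-excluded-middle)) λ H? →
    ¬< (≤-<-trans (Nim.two-colours-bound H H? v bipartite χ xs nim j₁~j₂ u (proj₂ ex-J) both n-large) gap)

  NIM≤ : (χ : Colouring n) {xs : List (Fin n × Fin n)} → Unique xs → AllNIM H χ xs → length xs ≤ b
  NIM≤ χ {xs} u nim with same-colour? χ xs
  ... | inj₂ both = <⇒≤ (two-colours< χ u nim both)
  ... | inj₁ (c , all-c) = proj₂ ex-H (edgeGraph xs ordered) (length xs) H-free (edgeGraph-NumEdges ordered u)
    where
    ordered : Ordered xs
    ordered xy = proj₁ (nim _ _ xy)
    mono : ∀ {x y} → Edge xs x y → Adj (colourClass χ c) x y
    mono (inj₁ xy) = proj₁ (proj₂ (nim _ _ xy)) , all-c xy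
    mono (inj₂ yx) = adjSym (colourClass χ c) (proj₁ (proj₂ (nim _ _ yx)) , all-c yx)
    H-free : HFree (edgeGraph xs ordered) H
    -- An edge of `J` is needed so that the monochromatic copy contains a NIM-edge.
    H-free (f , f-injective , adj) = J-has-edge λ (i , j , i~j) →
      edge⇒¬InMonoCopy H χ nim (adj _ _ i~j)
        (c , f , (f-injective , λ i j → mono ∘ adj i j) , _ , _ , i~j , refl , refl)

  extremal-colouring : ∃ λ (χ : Colouring n) → NumNIM H χ b
  extremal-colouring with proj₁ ex-H
  ... | G , H-free , xs , u , length-xs , edges , _ =
    χ , xs , u , length-xs , nim , λ x y x<y nim-xy → complete x<y nim-xy
    where
    χ : Colouring n
    χ = record
      { col    = λ x y → does (edge? xs x y)
      ; colSym = λ x y → does-⇔ (mk⇔ edge-sym edge-sym) (edge? xs x y) (edge? xs y x)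
      }
    edge⇒Adj : ∀ {x y} → Edge xs x y → Adj G x y
    edge⇒Adj (inj₁ xy) = proj₂ (edges _ _ xy)
    edge⇒Adj (inj₂ yx) = adjSym G (proj₂ (edges _ _ yx))
    does-true : ∀ {P : Set} (P? : Dec P) → does P? ≡ true → P
    does-true (yes p) _ = p
    nim : AllNIM H χ xs
    nim x y xy = proj₁ (edges x y xy) , (λ { refl → irrefl G (proj₂ (edges x y xy)) }) , ¬mono
      where
      ¬mono : ¬ InMonoCopy H χ x y
      ¬mono (c , f , (f-injective , adj) , i , j , i~j , refl , refl)
        -- The copy uses an edge of `G`, so its colour is `true` and all of it lies in `G`.
        with refl ← trans (sym (dec-true (edge? xs x y) (inj₁ xy))) (proj₂ (adj i j i~j)) =
        H-free (f , f-injective , λ i j i~j → edge⇒Adj (does-true (edge? xs (f i) (f j)) (proj₂ (adj i j i~j))))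
    -- A NIM-edge outside `xs` would make `b + 1` NIM-edges, against `NIM≤`.
    complete : ∀ {x y} → x Fin.< y → IsNIM H χ x y → (x , y) ∈ xs
    complete {x} {y} x<y nim-xy with edge? xs x y
    ... | yes e = edge-ordered (λ xy → proj₁ (edges _ _ xy)) x<y e
    ... | no ¬e = contradiction (NIM≤ χ (∷-unique (¬e ∘ inj₁) u) nim⁺) (<⇒≱ (s≤s (≤-reflexive (sym length-xs))))
      where
      nim⁺ : AllNIM H χ ((x , y) ∷ xs)
      nim⁺ _ _ (here refl) = x<y , nim-xy
      nim⁺ x y (there xy)  = nim x y xy

  module _ (χ : Colouring n) (xs : List (Fin n × Fin n)) (u : Unique xs) (length-xs : length xs ≡ b)
           (nim : AllNIM H χ xs) (c : Bool) (all-c : ∀ {x y} → (x , y) ∈ xs → col χ x y ≡ c) where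

    -- A further c-edge would create a copy of H. Of an edge at v and an edge off v, only one can use the new edge.
    colour⇒NIM : ∀ {x y} → x Fin.< y → col χ x y ≡ c → (x , y) ∈ xs
    colour⇒NIM {x} {y} x<y xy-c with edge? xs x y
    ... | yes e = edge-ordered (λ xy → proj₁ (nim _ _ xy)) x<y e
    ... | no ¬e = contradiction (proj₂ ex-H (edgeGraph xs⁺ ordered) (suc (length xs)) H-free
                                  (edgeGraph-NumEdges ordered (∷-unique (¬e ∘ inj₁) u)))
                                (<⇒≱ (s≤s (≤-reflexive (sym length-xs))))
      where
      xs⁺ : List (Fin n × Fin n)
      xs⁺ = (x , y) ∷ xs
      ordered : Ordered xs⁺
      ordered (here refl) = x<y
      ordered (there xy)  = proj₁ (nim _ _ xy)
      mono⁺ : ∀ {x′ y′} → (x′ , y′) ∈ xs⁺ → Adj (colourClass χ c) x′ y′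
      mono⁺ e@(here refl) = <⇒≢ (ordered e) ∘ cong Fin.toℕ , xy-c
      mono⁺ e@(there xy)  = <⇒≢ (ordered e) ∘ cong Fin.toℕ , all-c xy
      mono : ∀ {x′ y′} → Edge xs⁺ x′ y′ → Adj (colourClass χ c) x′ y′
      mono = [ mono⁺ , adjSym (colourClass χ c) ∘ mono⁺ ]′
      H-free : HFree (edgeGraph xs⁺ ordered) H
      H-free (f , f-injective , adj) = v-has-neighbour λ (t , v~t) → J-has-edge λ (i , j , i~j) → clash v~t i~j
        where
        on-new-edge : ∀ {i j} → Adj H i j → (f i ≡ x × f j ≡ y) ⊎ (f i ≡ y × f j ≡ x)
        on-new-edge {i} {j} i~j = locate (adj i j i~j)
          where
          old : ¬ Edge xs (f i) (f j)
          old e = edge⇒¬InMonoCopy H χ nim e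
            (c , f , (f-injective , λ i j → mono ∘ adj i j) , i , j , i~j , refl , refl)
          locate : Edge xs⁺ (f i) (f j) → (f i ≡ x × f j ≡ y) ⊎ (f i ≡ y × f j ≡ x)
          locate (inj₁ (here e))  = inj₁ (cong proj₁ e , cong proj₂ e)
          locate (inj₁ (there e)) = ⊥-elim (old (inj₁ e))
          locate (inj₂ (here e))  = inj₂ (cong proj₂ e , cong proj₁ e)
          locate (inj₂ (there e)) = ⊥-elim (old (inj₂ e))
        f-v≢ : ∀ j {z} → f v ≡ z → f (punchIn v j) ≢ z
        f-v≢ j e e′ = Fin.punchInᵢ≢i v j (f-injective (trans e′ (sym e)))
        clash : ∀ {t i j} → Adj H v t → Adj J i j → ⊥
        clash {i = i} {j} v~t i~j with on-new-edge v~t | on-new-edge i~j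
        ... | inj₁ (v-x , _) | inj₁ (i-x , _) = f-v≢ i v-x i-x
        ... | inj₁ (v-x , _) | inj₂ (_ , j-x) = f-v≢ j v-x j-x
        ... | inj₂ (v-y , _) | inj₁ (_ , j-y) = f-v≢ j v-y j-y
        ... | inj₂ (v-y , _) | inj₂ (i-y , _) = f-v≢ i v-y i-y

    -- By `colour⇒NIM` the edges of the class are exactly the `b` NIM-edges, and a copy of `H` in
    -- the class would contain one of them.
    colour-class-extremal : IsMaxHFree (colourClass χ c) H
    colour-class-extremal = H-free , b , ex-H , xs , u , length-xs
      , (λ x y xy → let x<y , x≢y , _ = nim x y xy in x<y , x≢y , all-c xy)
      , (λ x y x<y (_ , e) → colour⇒NIM x<y e)
      where
      H-free : HFree (colourClass χ c) H
      H-free (f , f-injective , adj) = J-has-edge λ (i , j , i~j) →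
        edge⇒¬InMonoCopy H χ nim (edge (adj _ _ i~j)) (c , f , (f-injective , adj) , _ , _ , i~j , refl , refl)
        where
        edge : ∀ {x y} → Adj (colourClass χ c) x y → Edge xs x y
        edge {x} {y} (x≢y , e) with Fin.<-cmp x y
        ... | tri< x<y _ _ = inj₁ (colour⇒NIM x<y e)
        ... | tri≈ _ x≡y _ = contradiction x≡y x≢y
        ... | tri> _ _ y<x = inj₂ (colour⇒NIM y<x (trans (colSym χ y x) e))

  nim≡ex : IsNim n H b
  nim≡ex = extremal-colouring , λ χ m (xs , u , length-xs , nim , _) → subst (_≤ b) length-xs (NIM≤ χ u nim)

  extremal-colour-class : ∀ (χ : Colouring n) m → IsNim n H m → NumNIM H χ m → Σ Bool λ c → IsMaxHFree (colourClass χ c) H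
  extremal-colour-class χ m (_ , ≤m) (xs , u , length-xs , nim , _) with same-colour? χ xs
  ... | inj₂ both = contradiction (two-colours< χ u nim both) (≤⇒≯ b≤)
    where
    b≤ : b ≤ length xs
    b≤ = subst (b ≤_) (sym length-xs) (≤m (proj₁ extremal-colouring) b (proj₂ extremal-colouring))
  ... | inj₁ (c , all-c) = c , colour-class-extremal χ xs u (≤-antisym (NIM≤ χ u nim) b≤) nim c all-c
    where
    b≤ : b ≤ length xs
    b≤ = subst (b ≤_) (sym length-xs) (≤m (proj₁ extremal-colouring) b (proj₂ extremal-colouring))

theorem1p11 : (k : ℕ) (H : Graph (suc k)) → WeaklyReducible H → Bipartite H →
    Σ ℕ λ n₀ → ∀ n → n ≥ n₀ →
    (Σ ℕ λ m → IsEx n H m × IsNim n H m)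
    × (∀ (χ : Colouring n) m → IsNim n H m → NumNIM H χ m →
    Σ Bool λ c → Σ (Graph n) λ G → IsMaxHFree G H × Iso (colourClass χ c) G)
-- The summands provide the gap between the extremal numbers, a vertex outside any copy of `J`, and
-- a monochromatic clique of size `2h`.
theorem1p11 k H (n₀ , v , reducible) bipartite = n₀ + (suc k + ramsey-bound) , λ n n≥ →
  let rest≤n = m+n≤o⇒n≤o n₀ n≥
      k<n = m+n≤o⇒m≤o (suc k) rest≤n
      n-large = m+n≤o⇒n≤o (suc k) rest≤n
      a , b , ex-J , ex-H , gap = reducible n (m+n≤o⇒m≤o n₀ n≥)
  in (b , ex-H , nim≡ex H v bipartite ex-J ex-H gap k<n n-large)
   , λ χ m is-nim num →
       let c , max = extremal-colour-class H v bipartite ex-J ex-H gap k<n n-large χ m is-nim num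
       -- The colour class is itself a maximum `H`-free graph, so the isomorphism is the identity.
       in c , colourClass χ c , max , id , id , (λ _ → refl) , (λ _ → refl) , λ _ _ → id , id
  where
  ramsey-bound : ℕ
  ramsey-bound = 2 ^ (suc k + suc k + (suc k + suc k))
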